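{- Let $0<q<1$, let $k\ge 1$ and $n\ge 1$ be integers, and let $r_1,\dots,r_k$ be real numbers with $0\le r_j<\infty$. Let $X_j$ be the number of successes of the $j$-th kind, $j=1,\dots,k$, in a sequence of $n$ independent Bernoulli trials with chain-composite failures (see context), where the probability of success of the $j$-th kind at the $i$-th trial is $$p_{j,i}=q^{r_j+i-1},\qquad j=1,2,\ldots,k,\ i=1,2,\ldots .$$ Then the probability function of the random vector $(X_1,X_2,\ldots,X_k)$ is given by $$P(X_1=x_1,\ldots,X_k=x_k)=q^{\sum_{j=1}^k\binom{n-\sum_{\nu=0}^{j-1}x_\nu}{2}+\sum_{j=1}^k\left(n-\sum_{\nu=0}^{j-1}x_\nu\right)r_j}\,(1-q)^{\sum_{j=1}^k\left(n-\sum_{\nu=1}^{j}x_\nu\right)}\,\left|s_{q^{ -1}}(n,x_1,\ldots,x_k;r_1,\ldots,r_k)\right|$$ for all $x_j\in\{0,1,\ldots,n\}$, $j=1,\dots,k$, with $\sum_{j=1}^k x_j\le n$ and $x_0=0$, where $$\left|s_{q^{ -1}}(n,x_1,\ldots,x_k;r_1,\ldots,r_k)\right|=(-1)^{\sum_{j=1}^k\left(n-\sum_{\nu=1}^{j}x_\nu\right)}\,q^{ -\sum_{j=1}^k\left(n-\sum_{\nu=1}^{j}x_\nu\right)}\,s_{q^{ -1}}(n,x_1,\ldots,x_k;r_1,\ldots,r_k).$$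
   Context: $q$-numbers: for real $t$ and real $u>0$, $u\ne 1$, $[t]_u=\frac{1-u^t}{1-u}$. An empty product equals $1$. Multiparameter noncentral $q$-Stirling numbers of the first kind: for $u>0$, $u\neq 1$, integers $x_1,\dots,x_k\ge 0$ with $\sum_j x_j\le n$, $x_0=0$, and reals $r_j\ge 0$, the signless numbers are $$|s_u(n,x_1,\ldots,x_k;r_1,\ldots,r_k)|=u^{nk-\sum_{j=1}^k(k-j+1)x_j}\sum\prod_{j=1}^k[r_j+m_{j,1}]_u[r_j+m_{j,2}]_u\cdots\left[r_j+m_{j,\,n-\sum_{\nu=1}^jx_\nu}\right]_u,$$ and the signed numbers are $$s_u(n,x_1,\ldots,x_k;r_1,\ldots,r_k)=\sum\prod_{j=1}^k(-1)^{n-\sum_{\nu=1}^jx_\nu}[r_j+m_{j,1}]_u[r_j+m_{j,2}]_u\cdots\left[r_j+m_{j,\,n-\sum_{\nu=1}^jx_\nu}\right]_u,$$ where in both cases the multiple sum is extended over all independent choices, for each $j=1,\dots,k$, of an $\left(n-\sum_{\nu=1}^j x_\nu\right)$-element subset $\{m_{j,1},\ldots,m_{j,\,n-\sum_{\nu=1}^{j}x_\nu}\}$ of $\{0,1,\ldots,n-\sum_{\nu=0}^{j-1}x_\nu-1\}$. The numbers with subscript $q^{ -1}$ are obtained by setting $u=q^{ -1}$ in these definitions. The symbol $|s_u(\cdots)|$ is the name of the signless numbers, defined by the first formula. Independent Bernoulli trials with chain-composite failures (with $k$ kinds of success and success probabilities $p_{j,i}$): first, $n$ independent trials numbered $i=1,\dots,n$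 are performed, the $i$-th one being a success of the first kind with probability $p_{1,i}$; $X_1$ is the number of successes of the first kind. The failures are then subjected to trials of the second kind: given $X_1=x_1$, one performs $n-x_1$ independent trials numbered $i=1,\dots,n-x_1$, the $i$-th being a success of the second kind with probability $p_{2,i}$; $X_2$ is the number of successes. In general, given $X_1=x_1,\dots,X_{j-1}=x_{j-1}$, one performs $n-\sum_{\nu=0}^{j-1}x_\nu$ (with $x_0=0$) independent trials of the $j$-th kind, numbered $i=1,\dots,n-\sum_{\nu=0}^{j-1}x_\nu$, the $i$-th of which is a success of the $j$-th kind with probability $p_{j,i}$ and a failure with probability $1-p_{j,i}$, independently of the earlier stages apart from the number of trials; $X_j$ is the number of successes of the $j$-th kind. Thus the probability of any specified pattern of successes and failures in all $k$ stages is the product over $j=1,\dots,k$ of the corresponding factors $p_{j,i}$ (successes) and $1-p_{j,i}$ (failures). -}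

module Defs where

open import Level using (_⊔_) renaming (suc to lsuc)
open import Algebra.Apartness.Bundles using (HeytingField)
open import Algebra.Bundles using (CommutativeRing; Semiring)
import Algebra.Definitions.RawMonoid as RawMonoidDefs
import Algebra.Definitions.RawSemiring as RawSemiringDefs
open import Data.Bool.Base using (if_then_else_)
open import Data.Fin.Base using (Fin; zero; suc; toℕ)
open import Data.Fin.Subset using (Subset; inside; outside; ∣_∣)
open import Data.List.Base as List
  using (List; [_]; _++_; map; concatMap; cartesianProductWith; filter; foldr)
open import Data.Nat.Base as ℕ using (ℕ; zero; suc; _∸_)
import Data.Nat.ListAction as ListAction
import Data.Nat.Properties as ℕ
open import Data.Product.Base using (Σ-syntax; ∃-syntax; _,_; proj₁; proj₂)
import Data.Product.Base as Product
open import Data.Sum.Base using (_⊎_)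
open import Data.Unit.Base using (⊤; tt)
open import Data.Vec.Base as Vec using (lookup)
open import Data.Vec.Functional as Vector using (Vector)
open import Function.Base using (_∘_)
open import Relation.Binary.Core using (Rel)
open import Relation.Binary.Structures using (IsStrictPartialOrder)
open import Relation.Nullary.Negation.Core using (¬_)
open import Relation.Unary using (Pred; Decidable)

-- The standard library has no real numbers, so they are given axiomatically:
-- an Archimedean, Cauchy-complete ordered field, together with real powers of
-- positive numbers.  The axioms determine the field up to unique isomorphism
-- (classically), and determine the power operation on it: for 1 < u it is the
-- monotone homomorphism t ↦ uᵗ with u¹ = u, and for u < 1 the law
-- (uˢ)ᵗ = uˢᵗ gives uᵗ = (u⁻¹)⁻ᵗ.  Apartness is the constructive form of ≠.

record RealNumbers c ℓ₁ ℓ₂ : Set (lsuc (c ⊔ ℓ₁ ⊔ ℓ₂)) where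
  infix 4 _<_ _≤_
  infixr 8 _^ᵣ_

  field
    heytingField : HeytingField c ℓ₁ ℓ₂

  open HeytingField heytingField public

  commutativeRing : CommutativeRing c ℓ₁
  commutativeRing = record { isCommutativeRing = isCommutativeRing }

  field
    _<_                    : Rel Carrier ℓ₂
    <-isStrictPartialOrder : IsStrictPartialOrder _≈_ _<_
    #⇒<⊎>                  : ∀ {x y} → x # y → x < y ⊎ y < x
    <⇒#                    : ∀ {x y} → x < y → x # y
    0<1                    : 0# < 1#
    +-monoˡ-<              : ∀ {x y} z → x < y → x + z < y + z
    *-monoˡ-<-pos          : ∀ {x y z} → 0# < z → x < y → x * z < y * z

  _≤_ : Rel Carrier ℓ₂
  x ≤ y = ¬ (y < x)

  fromℕ : ℕ → Carrier
  fromℕ n = RawMonoidDefs._×_ (CommutativeRing.+-rawMonoid commutativeRing) n 1#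

  IsCauchy : (ℕ → Carrier) → Set (c ⊔ ℓ₂)
  IsCauchy f = ∀ ε → 0# < ε → ∃[ N ] (∀ m n → N ℕ.≤ m → N ℕ.≤ n → f m < f n + ε)

  _ConvergesTo_ : (ℕ → Carrier) → Carrier → Set (c ⊔ ℓ₂)
  f ConvergesTo l =
    ∀ ε → 0# < ε → ∃[ N ] (∀ n → N ℕ.≤ n → f n < l + ε Product.× l < f n + ε)

  ℝ⁺ : Set (c ⊔ ℓ₂)
  ℝ⁺ = ∃[ u ] 0# < u

  field
    archimedean : ∀ x → ∃[ n ] x < fromℕ n
    complete    : ∀ f → IsCauchy f → ∃[ l ] f ConvergesTo l

    _^ᵣ_      : ℝ⁺ → Carrier → Carrier
    ^ᵣ-cong   : ∀ {u v s t} → proj₁ u ≈ proj₁ v → s ≈ t → u ^ᵣ s ≈ v ^ᵣ t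
    ^ᵣ-pos    : ∀ u t → 0# < u ^ᵣ t
    ^ᵣ-1      : ∀ u → u ^ᵣ 1# ≈ proj₁ u
    ^ᵣ-+      : ∀ u s t → u ^ᵣ (s + t) ≈ u ^ᵣ s * u ^ᵣ t
    ^ᵣ-*      : ∀ u s t → (u ^ᵣ s , ^ᵣ-pos u s) ^ᵣ t ≈ u ^ᵣ (s * t)
    ^ᵣ-mono-< : ∀ u {s t} → 1# < proj₁ u → s < t → u ^ᵣ s < u ^ᵣ t

sumℕ : ∀ {k} → Vector ℕ k → ℕ
sumℕ = RawMonoidDefs.sum ℕ.+-0-rawMonoid

-- partialSum x m = x₁ + ⋯ + xₘ.  The index j = 1, …, k of a vector is
-- represented by i : Fin k with j = suc (toℕ i).
partialSum : ∀ {k} → Vector ℕ k → ℕ → ℕ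
partialSum x m = ListAction.sum (List.take m (Vector.toList x))

-- n - ∑_{ν=0}^{j-1} x_ν  (with x₀ = 0) and  n - ∑_{ν=1}^{j} x_ν,
-- meaningful for ∑ⱼ xⱼ ≤ n, when nothing is truncated.
trials failures : ∀ {k} → ℕ → Vector ℕ k → Fin k → ℕ
trials   n x i = n ∸ partialSum x (toℕ i)
failures n x i = n ∸ partialSum x (suc (toℕ i))

subsets : ∀ n → List (Subset n)
subsets zero    = [ Vec.[] ]
subsets (suc n) = map (outside Vec.∷_) (subsets n) ++ map (inside Vec.∷_) (subsets n)

subsetsOfSize : ∀ n → ℕ → List (Subset n)
subsetsOfSize n m = filter (λ M → ∣ M ∣ ℕ.≟ m) (subsets n)

extend : ∀ {a k} {A : Fin (suc k) → Set a} → A zero → (∀ i → A (suc i)) → ∀ i → A i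
extend a f zero    = a
extend a f (suc i) = f i

-- All ways of choosing, for every i, an entry of the i-th list.
choices : ∀ {a k} {A : Fin k → Set a} → (∀ i → List (A i)) → List (∀ i → A i)
choices {k = zero}      L = [ (λ ()) ]
choices {k = suc _} {A} L =
  cartesianProductWith (extend {A = A}) (L zero) (choices (λ i → L (suc i)))

-- Patterns of successes and failures in k stages starting with n trials.  A
-- stage is given by its set of successes (the trial numbered i is the element
-- i - 1 of Fin n); its failures are the trials of the next stage.
Pattern : ℕ → ℕ → Set
Pattern zero    n = ⊤
Pattern (suc k) n = Σ[ S ∈ Subset n ] Pattern k (n ∸ ∣ S ∣)

patterns : ∀ k n → List (Pattern k n)
patterns zero    n = [ tt ]
patterns (suc k) n = concatMap (λ S → map (S ,_) (patterns k (n ∸ ∣ S ∣))) (subsets n)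

X : ∀ {k n} → Fin k → Pattern k n → ℕ
X zero    (S , _) = ∣ S ∣
X (suc i) (_ , ω) = X i ω

module RealTheory {c ℓ₁ ℓ₂} (ℝ : RealNumbers c ℓ₁ ℓ₂) where

  open RealNumbers ℝ hiding (zero)
  open RawSemiringDefs (Semiring.rawSemiring (CommutativeRing.semiring commutativeRing)) public
    using (_^_; sum; product)

  sumList : List Carrier → Carrier
  sumList = foldr _+_ 0#

  -- p i m is the success probability at the m-th trial of stage i, m = 1, 2, ….
  patternProbability : ∀ {k n} → Vector (ℕ → Carrier) k → Pattern k n → Carrier
  patternProbability {zero}  p _       = 1#
  patternProbability {suc k} p (S , ω) =
    product (λ i → let pᵢ = p zero (suc (toℕ i)) in if lookup S i then pᵢ else 1# - pᵢ)
      * patternProbability (p ∘ suc) ω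

  ℙ : ∀ {k n ℓ} → Vector (ℕ → Carrier) k →
      {E : Pred (Pattern k n) ℓ} → Decidable E → Carrier
  ℙ {k} {n} p E? = sumList (map (patternProbability p) (filter E? (patterns k n)))

  record Base : Set (c ⊔ ℓ₂) where
    field
      positive : ℝ⁺
      #1       : proj₁ positive # 1#

  open Base public

  [_]⟨_⟩ : Carrier → Base → Carrier
  [ t ]⟨ u ⟩ = (1# - positive u ^ᵣ t) * proj₁ (#⇒invertible (#-sym (#1 u)))

  qProduct : ∀ {N} → Base → Carrier → Subset N → Carrier
  qProduct u r M = product (λ m → if lookup M m then [ r + fromℕ (toℕ m) ]⟨ u ⟩ else 1#)

  stirlingChoices : ∀ {k} n (x : Vector ℕ k) → List (∀ i → Subset (trials n x i))
  stirlingChoices n x = choices (λ i → subsetsOfSize (trials n x i) (failures n x i))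

  -- The signless numbers |s_u(n,x₁,…,xₖ;r₁,…,rₖ)|.  With j = suc (toℕ i), the
  -- coefficient k - j + 1 is k ∸ toℕ i.
  signlessStirling : ∀ {k} → Base → ℕ → Vector ℕ k → Vector Carrier k → Carrier
  signlessStirling {k} u n x r =
    positive u ^ᵣ (fromℕ (n ℕ.* k) - fromℕ (sumℕ λ i → (k ∸ toℕ i) ℕ.* x i))
      * sumList (map (λ M → product λ i → qProduct u (r i) (M i)) (stirlingChoices n x))

  signedStirling : ∀ {k} → Base → ℕ → Vector ℕ k → Vector Carrier k → Carrier
  signedStirling u n x r =
    sumList (map (λ M → product λ i → (- 1#) ^ failures n x i * qProduct u (r i) (M i))
                 (stirlingChoices n x))

  module _ (q : Carrier) (0<q : 0# < q) (q<1 : q < 1#) where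

    private
      module R = CommutativeRing commutativeRing
      module < = IsStrictPartialOrder <-isStrictPartialOrder
      open import Relation.Binary.Reasoning.Setoid R.setoid
      open import Algebra.Properties.Ring R.ring using (-0#≈0#)

      q⁺ : ℝ⁺
      q⁺ = q , 0<q

      q-0≈q : q - 0# ≈ q
      q-0≈q = R.trans (R.+-congˡ -0#≈0#) (R.+-identityʳ q)

      q*q⁰≈q : q * q⁺ ^ᵣ 0# ≈ q
      q*q⁰≈q = begin
        q * q⁺ ^ᵣ 0#          ≈⟨ R.*-congʳ (^ᵣ-1 q⁺) ⟨
        q⁺ ^ᵣ 1# * q⁺ ^ᵣ 0#   ≈⟨ ^ᵣ-+ q⁺ 1# 0# ⟨
        q⁺ ^ᵣ (1# + 0#)       ≈⟨ ^ᵣ-cong R.refl (R.+-identityʳ 1#) ⟩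
        q⁺ ^ᵣ 1#              ≈⟨ ^ᵣ-1 q⁺ ⟩
        q                     ∎

      q⁰≈1 : q⁺ ^ᵣ 0# ≈ 1#
      q⁰≈1 with v , vq≈1 , _ ← #⇒invertible (#-sym (<⇒# 0<q)) = begin
        q⁺ ^ᵣ 0#                    ≈⟨ R.*-identityˡ _ ⟨
        1# * q⁺ ^ᵣ 0#               ≈⟨ R.*-congʳ vq≈1 ⟨
        v * (q - 0#) * q⁺ ^ᵣ 0#     ≈⟨ R.*-congʳ (R.*-congˡ q-0≈q) ⟩
        v * q * q⁺ ^ᵣ 0#            ≈⟨ R.*-assoc _ _ _ ⟩
        v * (q * q⁺ ^ᵣ 0#)          ≈⟨ R.*-congˡ q*q⁰≈q ⟩
        v * q                       ≈⟨ R.*-congˡ q-0≈q ⟨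
        v * (q - 0#)                ≈⟨ vq≈1 ⟩
        1#                          ∎

      qq⁻¹≈1 : q * q⁺ ^ᵣ (- 1#) ≈ 1#
      qq⁻¹≈1 = begin
        q * q⁺ ^ᵣ (- 1#)          ≈⟨ R.*-congʳ (^ᵣ-1 q⁺) ⟨
        q⁺ ^ᵣ 1# * q⁺ ^ᵣ (- 1#)   ≈⟨ ^ᵣ-+ q⁺ 1# (- 1#) ⟨
        q⁺ ^ᵣ (1# - 1#)           ≈⟨ ^ᵣ-cong R.refl (R.-‿inverseʳ 1#) ⟩
        q⁺ ^ᵣ 0#                  ≈⟨ q⁰≈1 ⟩
        1#                        ∎

      1<q⁻¹ : 1# < q⁺ ^ᵣ (- 1#)
      1<q⁻¹ = <.<-respˡ-≈ qq⁻¹≈1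
                (<.<-respʳ-≈ (R.*-identityˡ _) (*-monoˡ-<-pos (^ᵣ-pos q⁺ (- 1#)) q<1))

    reciprocalBase : Base
    reciprocalBase = record
      { positive = q⁺ ^ᵣ (- 1#) , ^ᵣ-pos q⁺ (- 1#)
      ; #1       = #-sym (<⇒# 1<q⁻¹)
      }

{-# OPTIONS --safe #-}
-- Summing the pattern probabilities stage by stage, and distributing the product in the
-- Stirling numbers over the independent choices, turns both sides into products over the
-- stages, so a single stage remains.  There one passes from the set of successes to its
-- complement M and uses 1 - qᵗ = qᵗ · (1 - q) q⁻¹ · [t]_{1/q} at each m ∈ M: every trial
-- contributes q^(r+m), and these factors multiply to q^(C(T,2) + T r) for T trials.
module Submission where

open import Defs
open import Level using (Level)
open import Algebra.Bundles using (CommutativeRing)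
import Algebra.Properties.CommutativeMonoid.Sum as CommutativeMonoidSum
import Algebra.Properties.Ring as RingProperties
import Algebra.Properties.Semiring.Exp as Exp
import Algebra.Properties.CommutativeSemiring.Exp as CommutativeExp
import Algebra.Properties.Monoid.Mult as Mult
import Algebra.Solver.CommutativeMonoid as CommutativeMonoidSolver
open import Data.Bool.Base using (true; false; not; if_then_else_)
open import Data.Fin.Base using (Fin; zero; suc; toℕ)
open import Data.Fin.Properties using (all?)
open import Data.Fin.Subset using (Subset; inside; outside; ∣_∣; ∁)
open import Data.Fin.Subset.Properties using (∣∁p∣≡n∸∣p∣; ∣p∣≤n)
open import Data.List.Base using (List; []; _∷_; _++_; map; filter; concatMap; cartesianProductWith)
open import Data.List.Properties using (map-++; map-∘; filter-++; filter-≐; filter-none)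
import Data.List.Relation.Unary.All as All
import Data.List.Relation.Unary.All.Properties as All
open import Data.Nat.Base as ℕ using (ℕ; zero; suc; _∸_)
open import Data.Nat.Combinatorics using (_C_; nCk+nC[k+1]≡[n+1]C[k+1]; nC1≡n)
open import Data.Nat.Properties as ℕ using (_≟_)
open import Data.Nat.Tactic.RingSolver using (solve-∀)
open import Data.Product.Base using (_×_; _,_; proj₁; proj₂)
open import Data.Vec.Base using ([]; _∷_; lookup)
open import Data.Vec.Functional using (Vector)
open import Data.Vec.Properties using (lookup-map)
open import Function.Base using (_∘_)
open import Function.Bundles using (mk⇔)
open import Relation.Binary.PropositionalEquality as ≡ using (_≡_)
open import Relation.Nullary.Decidable using (does; yes; no; does-⇔)
open import Relation.Nullary.Negation using (¬_)
open import Relation.Unary using (Pred; Decidable)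

-- List filtering, and arithmetic of the trial and failure counts.

filter-map : ∀ {a b p} {A : Set a} {B : Set b} {P : Pred B p} (P? : Decidable P) (f : A → B) xs →
             filter P? (map f xs) ≡ map f (filter (P? ∘ f) xs)
filter-map P? f []       = ≡.refl
filter-map P? f (x ∷ xs) with does (P? (f x))
... | true  = ≡.cong (f x ∷_) (filter-map P? f xs)
... | false = filter-map P? f xs

-- Removing the first stage leaves a system of the same kind started with `n ∸ x zero` trials; the
-- inductions over the stages rest on this.
trials-suc : ∀ {k} n (x : Vector ℕ (suc k)) i →
             trials n x (suc i) ≡ trials (n ∸ x zero) (x ∘ suc) i
trials-suc n x i = ≡.sym (ℕ.∸-+-assoc n (x zero) _)

failures-suc : ∀ {k} n (x : Vector ℕ (suc k)) i →
               failures n x (suc i) ≡ failures (n ∸ x zero) (x ∘ suc) i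
failures-suc n x i = ≡.sym (ℕ.∸-+-assoc n (x zero) _)

-- Matches the set sizes prescribed in the Stirling numbers with the sizes of complements of success
-- sets.
failures≡trials∸x : ∀ {k} n (x : Vector ℕ k) i → failures n x i ≡ trials n x i ∸ x i
failures≡trials∸x n x zero    = ≡.cong (n ∸_) (ℕ.+-identityʳ (x zero))
failures≡trials∸x n x (suc i) = begin
  failures n x (suc i)                              ≡⟨ failures-suc n x i ⟩
  failures (n ∸ x zero) (x ∘ suc) i                 ≡⟨ failures≡trials∸x (n ∸ x zero) (x ∘ suc) i ⟩
  trials (n ∸ x zero) (x ∘ suc) i ∸ x (suc i)       ≡⟨ ≡.cong (_∸ x (suc i)) (trials-suc n x i) ⟨
  trials n x (suc i) ∸ x (suc i)                    ∎
  where open ≡.≡-Reasoning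

sum-tail≤ : ∀ {k n} (x : Vector ℕ (suc k)) → sumℕ x ℕ.≤ n → sumℕ (x ∘ suc) ℕ.≤ n ∸ x zero
sum-tail≤ {n = n} x Σx≤n =
  ℕ.≤-trans (ℕ.≤-reflexive (≡.sym (ℕ.m+n∸m≡n (x zero) _))) (ℕ.∸-monoˡ-≤ (x zero) Σx≤n)

-- Keeps `trials n x i ∸ x i` from truncating, so that sets of successes and their complements
-- correspond by size.
x≤trials : ∀ {k} n (x : Vector ℕ k) → sumℕ x ℕ.≤ n → ∀ i → x i ℕ.≤ trials n x i
x≤trials n x Σx≤n zero    = ℕ.m+n≤o⇒m≤o (x zero) Σx≤n
x≤trials n x Σx≤n (suc i) = ≡.subst (x (suc i) ℕ.≤_) (≡.sym (trials-suc n x i))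
  (x≤trials (n ∸ x zero) (x ∘ suc) (sum-tail≤ x Σx≤n) i)

sumℕ-cong : ∀ {k} {x y : Vector ℕ k} → (∀ i → x i ≡ y i) → sumℕ x ≡ sumℕ y
sumℕ-cong = CommutativeMonoidSum.sum-cong-≗ ℕ.+-0-commutativeMonoid

-- The exponent nk - ∑ⱼ (k-j+1) xⱼ of the signless numbers is ∑ⱼ (n - x₁ - ⋯ - xⱼ).
sum-failures : ∀ {k} n (x : Vector ℕ k) → sumℕ x ℕ.≤ n →
               sumℕ (failures n x) ℕ.+ sumℕ (λ i → (k ∸ toℕ i) ℕ.* x i) ≡ n ℕ.* k
sum-failures {zero}  n x Σx≤n = ≡.sym (ℕ.*-zeroʳ n)
sum-failures {suc k} n x Σx≤n = begin
  failures n x zero ℕ.+ sumℕ (failures n x ∘ suc) ℕ.+ (suc k ℕ.* x₀ ℕ.+ w)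
    ≡⟨ ≡.cong₂ (λ a b → a ℕ.+ b ℕ.+ (suc k ℕ.* x₀ ℕ.+ w))
         (failures≡trials∸x n x zero) (sumℕ-cong (failures-suc n x)) ⟩
  m ℕ.+ f ℕ.+ (suc k ℕ.* x₀ ℕ.+ w)
    ≡⟨ regroup m f x₀ w k ⟩
  m ℕ.+ (f ℕ.+ w) ℕ.+ suc k ℕ.* x₀
    ≡⟨ ≡.cong (λ a → m ℕ.+ a ℕ.+ suc k ℕ.* x₀) (sum-failures m (x ∘ suc) (sum-tail≤ x Σx≤n)) ⟩
  m ℕ.+ m ℕ.* k ℕ.+ suc k ℕ.* x₀
    ≡⟨ factor m x₀ k ⟩
  (m ℕ.+ x₀) ℕ.* suc k
    ≡⟨ ≡.cong (ℕ._* suc k) (ℕ.m∸n+n≡m (ℕ.m+n≤o⇒m≤o x₀ Σx≤n)) ⟩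
  n ℕ.* suc k ∎
  where
  open ≡.≡-Reasoning
  x₀ = x zero
  m = n ∸ x₀
  f = sumℕ (failures m (x ∘ suc))
  w = sumℕ (λ i → (k ∸ toℕ i) ℕ.* x (suc i))
  regroup : ∀ m f x₀ w k → m ℕ.+ f ℕ.+ (suc k ℕ.* x₀ ℕ.+ w) ≡ m ℕ.+ (f ℕ.+ w) ℕ.+ suc k ℕ.* x₀
  regroup = solve-∀
  factor : ∀ m x₀ k → m ℕ.+ m ℕ.* k ℕ.+ suc k ℕ.* x₀ ≡ (m ℕ.+ x₀) ℕ.* suc k
  factor = solve-∀

[1+n]C2≡n+nC2 : ∀ n → suc n C 2 ≡ n ℕ.+ n C 2
[1+n]C2≡n+nC2 n = ≡.trans (≡.sym (nCk+nC[k+1]≡[n+1]C[k+1] n 1)) (≡.cong (ℕ._+ n C 2) (nC1≡n n))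

module _ {c ℓ₁ ℓ₂} (ℝ : RealNumbers c ℓ₁ ℓ₂) where

  open RealNumbers ℝ hiding (zero)
  open RealTheory ℝ
  private module R = CommutativeRing commutativeRing
  open RingProperties R.ring using (-‿distribˡ-*; ⁻¹-anti-homo‿-; -‿involutive; -1*x≈-x; x[y-z]≈xy-xz)
  open import Relation.Binary.Reasoning.Setoid R.setoid
  open CommutativeMonoidSum R.*-commutativeMonoid using ()
    renaming (sum-cong-≋ to product-cong; ∑-distrib-+ to product-distrib-*)
  open CommutativeMonoidSolver R.*-commutativeMonoid using (solve; _⊕_; _⊜_)
  open Exp R.semiring using (^-congˡ; ^-congʳ; ^-homo-*)
  open CommutativeExp R.commutativeSemiring using (^-distrib-*)

  -- Finite sums over lists: filtering, distributivity, independent choices.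

  sumList-++ : ∀ xs ys → sumList (xs ++ ys) ≈ sumList xs + sumList ys
  sumList-++ []       ys = R.sym (R.+-identityˡ _)
  sumList-++ (x ∷ xs) ys = R.trans (R.+-congˡ (sumList-++ xs ys)) (R.sym (R.+-assoc _ _ _))

  module _ {a} {A : Set a} where

    sumList-map-++ : ∀ (f : A → Carrier) xs ys →
                     sumList (map f (xs ++ ys)) ≈ sumList (map f xs) + sumList (map f ys)
    sumList-map-++ f xs ys =
      R.trans (R.reflexive (≡.cong sumList (map-++ f xs ys))) (sumList-++ (map f xs) (map f ys))

    sumList-cong : ∀ {f g : A → Carrier} → (∀ a → f a ≈ g a) → ∀ xs →
                   sumList (map f xs) ≈ sumList (map g xs)
    sumList-cong f≈g []       = R.refl
    sumList-cong f≈g (x ∷ xs) = R.+-cong (f≈g x) (sumList-cong f≈g xs)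

    *-distribˡ-sumList : ∀ c (f : A → Carrier) xs →
                         c * sumList (map f xs) ≈ sumList (map (λ a → c * f a) xs)
    *-distribˡ-sumList c f []       = R.zeroʳ c
    *-distribˡ-sumList c f (x ∷ xs) =
      R.trans (R.distribˡ _ _ _) (R.+-congˡ (*-distribˡ-sumList c f xs))

    module _ {p} {P : Pred A p} (P? : Decidable P) where

      sumList-filter : ∀ (f : A → Carrier) xs →
        sumList (map f (filter P? xs)) ≈ sumList (map (λ a → if does (P? a) then f a else 0#) xs)
      sumList-filter f []       = R.refl
      sumList-filter f (x ∷ xs) with does (P? x)
      ... | true  = R.+-congˡ (sumList-filter f xs)
      ... | false = R.trans (sumList-filter f xs) (R.sym (R.+-identityˡ _))

      sumList-filter-cong : ∀ {f g : A → Carrier} → (∀ {a} → P a → f a ≈ g a) → ∀ xs →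
        sumList (map f (filter P? xs)) ≈ sumList (map g (filter P? xs))
      sumList-filter-cong f≈g []       = R.refl
      sumList-filter-cong f≈g (x ∷ xs) with P? x
      ... | yes px = R.+-cong (f≈g px) (sumList-filter-cong f≈g xs)
      ... | no  _  = sumList-filter-cong f≈g xs

  sumList-map-∘ : ∀ {a b} {A : Set a} {B : Set b} (f : B → Carrier) (g : A → B) xs →
                  sumList (map f (map g xs)) ≈ sumList (map (f ∘ g) xs)
  sumList-map-∘ f g xs = R.reflexive (≡.cong sumList (≡.sym (map-∘ xs)))

  sumList-cartesianProductWith :
    ∀ {a b d} {A : Set a} {B : Set b} {D : Set d} (_∙_ : A → B → D)
      (h : D → Carrier) (f : A → Carrier) (g : B → Carrier) →
    (∀ a b → h (a ∙ b) ≈ f a * g b) → ∀ xs ys →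
    sumList (map h (cartesianProductWith _∙_ xs ys)) ≈ sumList (map f xs) * sumList (map g ys)
  sumList-cartesianProductWith _∙_ h f g h≈fg []       ys = R.sym (R.zeroˡ _)
  sumList-cartesianProductWith _∙_ h f g h≈fg (x ∷ xs) ys = begin
    sumList (map h (map (x ∙_) ys ++ cartesianProductWith _∙_ xs ys))
      ≈⟨ sumList-map-++ h (map (x ∙_) ys) _ ⟩
    sumList (map h (map (x ∙_) ys)) + sumList (map h (cartesianProductWith _∙_ xs ys))
      ≈⟨ R.+-cong (sumList-map-∘ h (x ∙_) ys) (sumList-cartesianProductWith _∙_ h f g h≈fg xs ys) ⟩
    sumList (map (λ y → h (x ∙ y)) ys) + sumList (map f xs) * sumList (map g ys)
      ≈⟨ R.+-congʳ (R.trans (sumList-cong (h≈fg x) ys) (R.sym (*-distribˡ-sumList (f x) g ys))) ⟩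
    f x * sumList (map g ys) + sumList (map f xs) * sumList (map g ys)
      ≈⟨ R.distribʳ _ _ _ ⟨
    (f x + sumList (map f xs)) * sumList (map g ys) ∎

  -- Conditioning on a first choice `a`: if `P a` fails, nothing that follows lies in the event;
  -- otherwise what follows contributes `f a` times a factor `c` common to all accepted `a`, which
  -- therefore leaves the sum.
  sumList-filter-concatMap :
    ∀ {a b p e} {A : Set a} {B : Set b} {P : Pred A p} {E : Pred B e}
      (P? : Decidable P) (E? : Decidable E) (g : A → List B)
      (h : B → Carrier) (f : A → Carrier) (c : Carrier) →
    (∀ a → P a → sumList (map h (filter E? (g a))) ≈ f a * c) →
    (∀ a → ¬ P a → filter E? (g a) ≡ []) → ∀ xs →
    sumList (map h (filter E? (concatMap g xs))) ≈ sumList (map f (filter P? xs)) * c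
  sumList-filter-concatMap P? E? g h f c accept reject []       = R.sym (R.zeroˡ c)
  sumList-filter-concatMap P? E? g h f c accept reject (x ∷ xs)
    rewrite filter-++ E? (g x) (concatMap g xs) with P? x
  ... | yes px = R.trans (sumList-map-++ h (filter E? (g x)) _) (R.trans
        (R.+-cong (accept x px) (sumList-filter-concatMap P? E? g h f c accept reject xs))
        (R.sym (R.distribʳ c _ _)))
  ... | no ¬px rewrite reject x ¬px = sumList-filter-concatMap P? E? g h f c accept reject xs

  -- Expansion of a product of sums: each term picks one entry from every list, and distributivity
  -- peels off one list at a time.
  sumList-choices : ∀ {a k} {A : Fin k → Set a} (L : ∀ i → List (A i)) (g : ∀ i → A i → Carrier) →
    sumList (map (λ M → product (λ i → g i (M i))) (choices L))
      ≈ product (λ i → sumList (map (g i) (L i)))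
  sumList-choices {k = zero}      L g = R.+-identityʳ 1#
  sumList-choices {k = suc _} {A} L g = R.trans
    (sumList-cartesianProductWith (extend {A = A}) _ (g zero)
      (λ M → product (λ i → g (suc i) (M i))) (λ _ _ → R.refl) (L zero) (choices (L ∘ suc)))
    (R.*-congˡ (sumList-choices (L ∘ suc) (g ∘ suc)))

  -- Reindexing sums over subsets by complements.

  -- Complementation exchanges the two halves of `subsets (suc n)`, the sets without and with the
  -- first element, so commutativity of addition closes the induction.
  sumList-∁ : ∀ n (f : Subset n → Carrier) →
              sumList (map (f ∘ ∁) (subsets n)) ≈ sumList (map f (subsets n))
  sumList-∁ zero    f = R.refl
  sumList-∁ (suc n) f = begin
    sumList (map (f ∘ ∁) (map (outside ∷_) Ss ++ map (inside ∷_) Ss))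
      ≈⟨ split (f ∘ ∁) ⟩
    sumList (map (f ∘ ∁ ∘ (outside ∷_)) Ss) + sumList (map (f ∘ ∁ ∘ (inside ∷_)) Ss)
      ≈⟨ R.+-cong (sumList-∁ n (f ∘ (inside ∷_))) (sumList-∁ n (f ∘ (outside ∷_))) ⟩
    sumList (map (f ∘ (inside ∷_)) Ss) + sumList (map (f ∘ (outside ∷_)) Ss)
      ≈⟨ R.+-comm _ _ ⟩
    sumList (map (f ∘ (outside ∷_)) Ss) + sumList (map (f ∘ (inside ∷_)) Ss)
      ≈⟨ split f ⟨
    sumList (map f (map (outside ∷_) Ss ++ map (inside ∷_) Ss)) ∎
    where
    Ss = subsets n
    split : ∀ (h : Subset (suc n) → Carrier) →
      sumList (map h (map (outside ∷_) Ss ++ map (inside ∷_) Ss))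
        ≈ sumList (map (h ∘ (outside ∷_)) Ss) + sumList (map (h ∘ (inside ∷_)) Ss)
    split h = R.trans (sumList-map-++ h (map (outside ∷_) Ss) _)
      (R.+-cong (sumList-map-∘ h (outside ∷_) Ss) (sumList-map-∘ h (inside ∷_) Ss))

  -- Writing the size condition as an indicator reduces this to a sum over all subsets. The
  -- hypothesis `s ≤ n` makes size `n ∸ s` of the complement imply size `s` of the set.
  sumList-subsetsOfSize-∁ : ∀ {n s} → s ℕ.≤ n → (f : Subset n → Carrier) →
    sumList (map (f ∘ ∁) (subsetsOfSize n s)) ≈ sumList (map f (subsetsOfSize n (n ∸ s)))
  sumList-subsetsOfSize-∁ {n} {s} s≤n f = begin
    sumList (map (f ∘ ∁) (subsetsOfSize n s))
      ≈⟨ sumList-filter (λ S → ∣ S ∣ ≟ s) (f ∘ ∁) (subsets n) ⟩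
    sumList (map (λ S → if does (∣ S ∣ ≟ s) then f (∁ S) else 0#) (subsets n))
      ≈⟨ sumList-cong (λ S → R.reflexive (≡.cong (λ b → if b then f (∁ S) else 0#) (size S))) (subsets n) ⟩
    sumList (map (λ S → if does (∣ ∁ S ∣ ≟ n ∸ s) then f (∁ S) else 0#) (subsets n))
      ≈⟨ sumList-∁ n (λ M → if does (∣ M ∣ ≟ n ∸ s) then f M else 0#) ⟩
    sumList (map (λ M → if does (∣ M ∣ ≟ n ∸ s) then f M else 0#) (subsets n))
      ≈⟨ sumList-filter (λ M → ∣ M ∣ ≟ n ∸ s) f (subsets n) ⟨
    sumList (map f (subsetsOfSize n (n ∸ s))) ∎
    where
    size : ∀ S → does (∣ S ∣ ≟ s) ≡ does (∣ ∁ S ∣ ≟ n ∸ s)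
    size S = does-⇔ (mk⇔
      (λ ∣S∣≡s → ≡.trans (∣∁p∣≡n∸∣p∣ S) (≡.cong (n ∸_) ∣S∣≡s))
      (λ ∣∁S∣≡n∸s → ℕ.∸-cancelˡ-≡ (∣p∣≤n S) s≤n (≡.trans (≡.sym (∣∁p∣≡n∸∣p∣ S)) ∣∁S∣≡n∸s)))
      (∣ S ∣ ≟ s) (∣ ∁ S ∣ ≟ n ∸ s)

  -- Factorization of the probability over the stages.

  stageProbability : ∀ {n} → (ℕ → Carrier) → Subset n → Carrier
  stageProbability p S =
    product (λ i → let pᵢ = p (suc (toℕ i)) in if lookup S i then pᵢ else 1# - pᵢ)

  stageSum : (ℕ → Carrier) → ℕ → ℕ → Carrier
  stageSum p n s = sumList (map (stageProbability p) (subsetsOfSize n s))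

  -- A stage influences later ones only through its number of successes. Once that number is
  -- prescribed, the later stages contribute the same sum for every admissible success set, and this
  -- sum factors out.
  ℙ-product : ∀ k n (p : Vector (ℕ → Carrier) k) (x : Vector ℕ k) →
    ℙ {k} {n} p (λ ω → all? (λ j → X j ω ≟ x j))
      ≈ product (λ i → stageSum (p i) (trials n x i) (x i))
  ℙ-product zero    n p x = R.+-identityʳ 1#
  ℙ-product (suc k) n p x = R.trans
    (sumList-filter-concatMap (λ S → ∣ S ∣ ≟ x zero) E? after (patternProbability p)
      (stageProbability (p zero)) (tailProduct (n ∸ x zero)) accept reject (subsets n))
    (R.*-congˡ (product-cong λ i →
      R.reflexive (≡.cong (λ m → stageSum (p (suc i)) m (x (suc i))) (≡.sym (trials-suc n x i)))))
    where
    E? : Decidable {A = Pattern (suc k) n} (λ ω → ∀ j → X j ω ≡ x j)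
    E? ω = all? (λ j → X j ω ≟ x j)

    E′? : ∀ {m} → Decidable {A = Pattern k m} (λ ω → ∀ j → X j ω ≡ x (suc j))
    E′? ω = all? (λ j → X j ω ≟ x (suc j))

    tailProduct : ℕ → Carrier
    tailProduct m = product (λ i → stageSum (p (suc i)) (trials m (x ∘ suc) i) (x (suc i)))

    after : (S : Subset n) → List (Pattern (suc k) n)
    after S = map (S ,_) (patterns k (n ∸ ∣ S ∣))

    accept : ∀ S → ∣ S ∣ ≡ x zero →
      sumList (map (patternProbability p) (filter E? (after S)))
        ≈ stageProbability (p zero) S * tailProduct (n ∸ x zero)
    accept S ∣S∣≡x₀ = begin
      sumList (map (patternProbability p) (filter E? (after S)))
        ≈⟨ R.reflexive (≡.cong (sumList ∘ map (patternProbability p)) (≡.trans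
             (filter-map E? (S ,_) ωs)
             (≡.cong (map (S ,_)) (filter-≐ (E? ∘ (S ,_)) E′?
               -- With the size of `S` known, the event for `(S , ω)` amounts to the event for `ω`
               -- alone.
               ((λ e → e ∘ suc) , (λ e → λ { zero → ∣S∣≡x₀ ; (suc j) → e j })) ωs)))) ⟩
      sumList (map (patternProbability p) (map (S ,_) (filter E′? ωs)))
        ≈⟨ sumList-map-∘ (patternProbability p) (S ,_) (filter E′? ωs) ⟩
      sumList (map (λ ω → stageProbability (p zero) S * patternProbability (p ∘ suc) ω) (filter E′? ωs))
        ≈⟨ *-distribˡ-sumList (stageProbability (p zero) S) (patternProbability (p ∘ suc)) (filter E′? ωs) ⟨
      stageProbability (p zero) S * ℙ (p ∘ suc) E′?
        ≈⟨ R.*-congˡ (ℙ-product k (n ∸ ∣ S ∣) (p ∘ suc) (x ∘ suc)) ⟩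
      stageProbability (p zero) S * tailProduct (n ∸ ∣ S ∣)
        -- The type of `ω` depends on `∣ S ∣`, so the size is rewritten only here, where it enters
        -- merely as a number.
        ≡⟨ ≡.cong (λ m → stageProbability (p zero) S * tailProduct (n ∸ m)) ∣S∣≡x₀ ⟩
      stageProbability (p zero) S * tailProduct (n ∸ x zero) ∎
      where ωs = patterns k (n ∸ ∣ S ∣)

    reject : ∀ S → ¬ ∣ S ∣ ≡ x zero → filter E? (after S) ≡ []
    reject S ∣S∣≢x₀ =
      filter-none E? (All.map⁺ (All.universal (λ ω e → ∣S∣≢x₀ (e zero)) (patterns k (n ∸ ∣ S ∣))))

  -- Natural and real powers, and products of powers.

  product-^ : ∀ {k} c (f : Vector ℕ k) → product (λ i → c ^ f i) ≈ c ^ sumℕ f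
  product-^ {zero}  c f = R.refl
  product-^ {suc k} c f = R.trans (R.*-congˡ (product-^ c (f ∘ suc))) (R.sym (^-homo-* c (f zero) _))

  product-if : ∀ {n} c (M : Subset n) → product (λ i → if lookup M i then c else 1#) ≈ c ^ ∣ M ∣
  product-if c []            = R.refl
  product-if c (inside ∷ M)  = R.*-congˡ (product-if c M)
  product-if c (outside ∷ M) = R.trans (R.*-identityˡ _) (product-if c M)

  fromℕ-+ : ∀ m n → fromℕ (m ℕ.+ n) ≈ fromℕ m + fromℕ n
  fromℕ-+ = Mult.×-homo-+ R.+-monoid 1#

  x+y-y≈x : ∀ x y → x + y - y ≈ x
  x+y-y≈x x y = R.trans (R.+-assoc _ _ _) (R.trans (R.+-congˡ (R.-‿inverseʳ y)) (R.+-identityʳ x))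

  x*y-x≈x[y-1] : ∀ x y → x * y - x ≈ x * (y - 1#)
  x*y-x≈x[y-1] x y = R.sym (R.trans (x[y-z]≈xy-xz x y 1#) (R.+-congˡ (R.-‿cong (R.*-identityʳ x))))

  ^ᵣ-congʳ : ∀ u {s t} → s ≈ t → u ^ᵣ s ≈ u ^ᵣ t
  ^ᵣ-congʳ u = ^ᵣ-cong R.refl

  -- u⁰ is an idempotent unit.
  ^ᵣ-0 : ∀ u → u ^ᵣ 0# ≈ 1#
  ^ᵣ-0 u with v , ve≈1 , _ ← #⇒invertible (#-sym (<⇒# (^ᵣ-pos u 0#))) = begin
    e                ≈⟨ R.*-identityˡ e ⟨
    1# * e           ≈⟨ R.*-congʳ ve≈1′ ⟨
    v * e * e        ≈⟨ R.*-assoc v e e ⟩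
    v * (e * e)      ≈⟨ R.*-congˡ (^ᵣ-+ u 0# 0#) ⟨
    v * u ^ᵣ (0# + 0#) ≈⟨ R.*-congˡ (^ᵣ-congʳ u (R.+-identityˡ 0#)) ⟩
    v * e            ≈⟨ ve≈1′ ⟩
    1#               ∎
    where
    e = u ^ᵣ 0#
    ve≈1′ : v * e ≈ 1#
    ve≈1′ = R.trans (R.*-congˡ (R.sym (x-0≈x e))) ve≈1
      where
      x-0≈x : ∀ x → x - 0# ≈ x
      x-0≈x x = R.trans (R.+-congʳ (R.sym (R.+-identityʳ x))) (x+y-y≈x x 0#)

  ^ᵣ-inverse : ∀ u t → u ^ᵣ t * u ^ᵣ (- t) ≈ 1#
  ^ᵣ-inverse u t = R.trans (R.sym (^ᵣ-+ u t (- t))) (R.trans (^ᵣ-congʳ u (R.-‿inverseʳ t)) (^ᵣ-0 u))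

  ^ᵣ-fromℕ : ∀ u n → u ^ᵣ fromℕ n ≈ proj₁ u ^ n
  ^ᵣ-fromℕ u zero    = ^ᵣ-0 u
  ^ᵣ-fromℕ u (suc n) = R.trans (^ᵣ-+ u 1# (fromℕ n)) (R.*-cong (^ᵣ-1 u) (^ᵣ-fromℕ u n))

  product-^ᵣ : ∀ {k} u (f : Vector Carrier k) → product (λ i → u ^ᵣ f i) ≈ u ^ᵣ sum f
  product-^ᵣ {zero}  u f = R.sym (^ᵣ-0 u)
  product-^ᵣ {suc k} u f = R.trans (R.*-congˡ (product-^ᵣ u (f ∘ suc))) (R.sym (^ᵣ-+ u (f zero) _))

  sum-fromℕ-+ : ∀ {k} (f : Vector ℕ k) (g : Vector Carrier k) →
                sum (λ i → fromℕ (f i) + g i) ≈ fromℕ (sumℕ f) + sum g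
  sum-fromℕ-+ f g = R.trans (CommutativeMonoidSum.∑-distrib-+ R.+-commutativeMonoid (fromℕ ∘ f) g)
    (R.+-congʳ (sum-fromℕ f))
    where
    sum-fromℕ : ∀ {k} (f : Vector ℕ k) → sum (fromℕ ∘ f) ≈ fromℕ (sumℕ f)
    sum-fromℕ {zero}  f = R.refl
    sum-fromℕ {suc k} f = R.trans (R.+-congˡ (sum-fromℕ (f ∘ suc))) (R.sym (fromℕ-+ (f zero) _))

  -- The exponents r, r+1, ..., r+n-1 add up to C(n,2) + nr. Splitting off the first factor restarts
  -- the progression at `r + 1#`, and the resulting surplus `n` is absorbed by C(n+1,2) = n +
  -- C(n,2).
  product-^ᵣ-progression : ∀ u n r →
    product {n} (λ i → u ^ᵣ (r + fromℕ (toℕ i))) ≈ u ^ᵣ (fromℕ (n C 2) + fromℕ n * r)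
  product-^ᵣ-progression u zero    r =
    R.sym (R.trans (^ᵣ-congʳ u (R.trans (R.+-identityˡ _) (R.zeroˡ r))) (^ᵣ-0 u))
  product-^ᵣ-progression u (suc n) r = begin
    u ^ᵣ (r + 0#) * product {n} (λ i → u ^ᵣ (r + (1# + fromℕ (toℕ i))))
      ≈⟨ R.*-cong (^ᵣ-congʳ u (R.+-identityʳ r))
                  (product-cong {n} λ i → ^ᵣ-congʳ u (R.sym (R.+-assoc r 1# _))) ⟩
    u ^ᵣ r * product {n} (λ i → u ^ᵣ (r + 1# + fromℕ (toℕ i)))
      ≈⟨ R.*-congˡ (product-^ᵣ-progression u n (r + 1#)) ⟩
    u ^ᵣ r * u ^ᵣ (fromℕ (n C 2) + fromℕ n * (r + 1#))
      ≈⟨ ^ᵣ-+ u _ _ ⟨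
    u ^ᵣ (r + (fromℕ (n C 2) + fromℕ n * (r + 1#)))
      ≈⟨ ^ᵣ-congʳ u exponent ⟩
    u ^ᵣ (fromℕ (suc n C 2) + fromℕ (suc n) * r) ∎
    where
    module + = CommutativeMonoidSolver R.+-commutativeMonoid
    exponent : r + (fromℕ (n C 2) + fromℕ n * (r + 1#)) ≈ fromℕ (suc n C 2) + fromℕ (suc n) * r
    exponent = begin
      r + (fromℕ (n C 2) + fromℕ n * (r + 1#))
        ≈⟨ R.+-congˡ (R.+-congˡ (R.trans (R.distribˡ _ _ _) (R.+-congˡ (R.*-identityʳ _)))) ⟩
      r + (fromℕ (n C 2) + (fromℕ n * r + fromℕ n))
        ≈⟨ +.solve 4 (λ a b c d → (a +.⊕ (b +.⊕ (c +.⊕ d))) +.⊜ ((d +.⊕ b) +.⊕ (a +.⊕ c))) R.refl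
             r (fromℕ (n C 2)) (fromℕ n * r) (fromℕ n) ⟩
      (fromℕ n + fromℕ (n C 2)) + (r + fromℕ n * r)
        ≈⟨ R.+-cong (R.trans (R.sym (fromℕ-+ n (n C 2))) (R.reflexive (≡.cong fromℕ (≡.sym ([1+n]C2≡n+nC2 n)))))
                    (R.sym (R.trans (R.distribʳ _ _ _) (R.+-congʳ (R.*-identityˡ r)))) ⟩
      fromℕ (suc n C 2) + fromℕ (suc n) * r ∎

  -- Stirling numbers as products over the stages.

  -- The elementary symmetric polynomial of degree `m` in the q-numbers of r, r+1, ..., r+n-1.
  qProductSum : Base → Carrier → ℕ → ℕ → Carrier
  qProductSum u r n m = sumList (map (qProduct u r) (subsetsOfSize n m))

  -- The sets of different stages are chosen independently, so the sum splits; `sum-failures` turns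
  -- the real exponent into a natural number.
  signlessStirling-product : ∀ {k} u n (x : Vector ℕ k) (r : Vector Carrier k) → sumℕ x ℕ.≤ n →
    signlessStirling u n x r
      ≈ proj₁ (positive u) ^ sumℕ (failures n x)
        * product (λ i → qProductSum u (r i) (trials n x i) (failures n x i))
  signlessStirling-product {k} u n x r Σx≤n = R.*-cong
    (R.trans (^ᵣ-congʳ (positive u) exponent) (^ᵣ-fromℕ (positive u) (sumℕ (failures n x))))
    (sumList-choices (λ i → subsetsOfSize (trials n x i) (failures n x i)) (λ i → qProduct u (r i)))
    where
    w = sumℕ (λ i → (k ∸ toℕ i) ℕ.* x i)
    exponent : fromℕ (n ℕ.* k) - fromℕ w ≈ fromℕ (sumℕ (failures n x))
    exponent = R.trans
      (R.+-congʳ (R.trans (R.reflexive (≡.cong fromℕ (≡.sym (sum-failures n x Σx≤n)))) (fromℕ-+ (sumℕ (failures n x)) w)))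
      (x+y-y≈x _ _)

  -- The sign depends on the stage but not on the chosen set, so it leaves each sum. The remaining
  -- product is the one in the signless numbers.
  signedStirling-product : ∀ {k} u n (x : Vector ℕ k) (r : Vector Carrier k) →
    signedStirling u n x r
      ≈ (- 1#) ^ sumℕ (failures n x)
        * product (λ i → qProductSum u (r i) (trials n x i) (failures n x i))
  signedStirling-product u n x r = begin
    signedStirling u n x r
      ≈⟨ sumList-choices (λ i → subsetsOfSize (trials n x i) (failures n x i))
                         (λ i M → (- 1#) ^ failures n x i * qProduct u (r i) M) ⟩
    product (λ i → sumList (map (λ M → (- 1#) ^ failures n x i * qProduct u (r i) M)
                                (subsetsOfSize (trials n x i) (failures n x i))))
      ≈⟨ product-cong (λ i → R.sym (*-distribˡ-sumList ((- 1#) ^ failures n x i) (qProduct u (r i))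
                                     (subsetsOfSize (trials n x i) (failures n x i)))) ⟩
    product (λ i → (- 1#) ^ failures n x i * qProductSum u (r i) (trials n x i) (failures n x i))
      ≈⟨ product-distrib-* (λ i → (- 1#) ^ failures n x i) _ ⟩
    product (λ i → (- 1#) ^ failures n x i)
      * product (λ i → qProductSum u (r i) (trials n x i) (failures n x i))
      ≈⟨ R.*-congʳ (product-^ (- 1#) (failures n x)) ⟩
    (- 1#) ^ sumℕ (failures n x)
      * product (λ i → qProductSum u (r i) (trials n x i) (failures n x i)) ∎

  [-1]^n*[-1]^n≈1 : ∀ n → (- 1#) ^ n * (- 1#) ^ n ≈ 1#
  [-1]^n*[-1]^n≈1 n = begin
    (- 1#) ^ n * (- 1#) ^ n   ≈⟨ ^-distrib-* (- 1#) (- 1#) n ⟨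
    (- 1# * - 1#) ^ n         ≈⟨ ^-congˡ n (R.trans (-1*x≈-x (- 1#)) (-‿involutive 1#)) ⟩
    1# ^ n                    ≈⟨ 1^n≈1 n ⟩
    1#                        ∎
    where
    1^n≈1 : ∀ n → 1# ^ n ≈ 1#
    1^n≈1 zero    = R.refl
    1^n≈1 (suc n) = R.trans (R.*-identityˡ _) (1^n≈1 n)

  -- A single stage with geometrically varying success probability.

  module _ (q : Carrier) (0<q : 0# < q) (q<1 : q < 1#) where

    private
      q⁺ : ℝ⁺
      q⁺ = q , 0<q

      u : Base
      u = reciprocalBase q 0<q q<1

      -- `w` equals `q⁻¹ - 1#`. In factored form its powers split into the power of `1# - q` in the
      -- formula and the power of `q⁻¹` in the signless numbers.
      q⁻¹ w : Carrier
      q⁻¹ = q⁺ ^ᵣ (- 1#)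
      w   = (1# - q) * q⁻¹

    q⁻¹^n : ∀ n → q⁻¹ ^ n ≈ q⁺ ^ᵣ (- fromℕ n)
    q⁻¹^n n = begin
      q⁻¹ ^ n                       ≈⟨ ^ᵣ-fromℕ (positive u) n ⟨
      positive u ^ᵣ fromℕ n         ≈⟨ ^ᵣ-* q⁺ (- 1#) (fromℕ n) ⟩
      q⁺ ^ᵣ (- 1# * fromℕ n)        ≈⟨ ^ᵣ-congʳ q⁺ (-1*x≈-x _) ⟩
      q⁺ ^ᵣ (- fromℕ n)             ∎

    w≈q⁻¹-1 : w ≈ q⁻¹ - 1#
    w≈q⁻¹-1 = begin
      (1# - q) * q⁻¹    ≈⟨ R.*-comm _ _ ⟩
      q⁻¹ * (1# - q)    ≈⟨ x[y-z]≈xy-xz q⁻¹ 1# q ⟩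
      q⁻¹ * 1# - q⁻¹ * q  ≈⟨ R.+-cong (R.*-identityʳ _) (R.-‿cong q⁻¹q≈1) ⟩
      q⁻¹ - 1#          ∎
      where
      q⁻¹q≈1 : q⁻¹ * q ≈ 1#
      q⁻¹q≈1 = R.trans (R.*-comm _ _) (R.trans (R.*-congʳ (R.sym (^ᵣ-1 q⁺))) (^ᵣ-inverse q⁺ 1#))

    -- Up to sign, `w` is the denominator of the q-number with base 1/q, so multiplying by it leaves
    -- only the numerator.
    w*[t]≈q⁻ᵗ-1 : ∀ t → w * [ t ]⟨ u ⟩ ≈ q⁺ ^ᵣ (- t) - 1#
    w*[t]≈q⁻ᵗ-1 t = begin
      w * ((1# - uᵗ) * v)                  ≈⟨ R.*-congʳ (R.trans w≈q⁻¹-1 (R.sym (⁻¹-anti-homo‿- 1# q⁻¹))) ⟩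
      -- The minus sign moves to the numerator, and `1# - q⁻¹` meets its inverse `v`.
      - (1# - q⁻¹) * ((1# - uᵗ) * v)       ≈⟨ rotate (1# - q⁻¹) (1# - uᵗ) v ⟩
      - (1# - uᵗ) * (v * (1# - q⁻¹))       ≈⟨ R.*-cong (⁻¹-anti-homo‿- 1# uᵗ)
                                                (proj₁ (proj₂ (#⇒invertible (#-sym (#1 u))))) ⟩
      (uᵗ - 1#) * 1#                       ≈⟨ R.*-identityʳ _ ⟩
      uᵗ - 1#                              ≈⟨ R.+-congʳ (R.trans (^ᵣ-* q⁺ (- 1#) t) (^ᵣ-congʳ q⁺ (-1*x≈-x t))) ⟩
      q⁺ ^ᵣ (- t) - 1#                     ∎
      where
      uᵗ = positive u ^ᵣ t
      v = proj₁ (#⇒invertible (#-sym (#1 u)))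
      rotate : ∀ a b c → - a * (b * c) ≈ - b * (c * a)
      rotate a b c = begin
        - a * (b * c)     ≈⟨ -‿distribˡ-* a (b * c) ⟨
        - (a * (b * c))   ≈⟨ R.-‿cong (R.trans (R.*-comm a _) (R.*-assoc b c a)) ⟩
        - (b * (c * a))   ≈⟨ -‿distribˡ-* b (c * a) ⟩
        - b * (c * a)     ∎

    -- Taking out qᵗ leaves q⁻ᵗ - 1. A failure thus carries the same power of q as a success, times
    -- an extra factor.
    1-qᵗ : ∀ t → 1# - q⁺ ^ᵣ t ≈ q⁺ ^ᵣ t * (w * [ t ]⟨ u ⟩)
    1-qᵗ t = begin
      1# - q⁺ ^ᵣ t                          ≈⟨ R.+-congʳ (^ᵣ-inverse q⁺ t) ⟨
      q⁺ ^ᵣ t * q⁺ ^ᵣ (- t) - q⁺ ^ᵣ t       ≈⟨ x*y-x≈x[y-1] _ _ ⟩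
      q⁺ ^ᵣ t * (q⁺ ^ᵣ (- t) - 1#)          ≈⟨ R.*-congˡ (w*[t]≈q⁻ᵗ-1 t) ⟨
      q⁺ ^ᵣ t * (w * [ t ]⟨ u ⟩)            ∎

    -- The powers of q occur at every trial, so their product is independent of `S`; the other
    -- factors differ from 1 only at failures, that is, on `∁ S`.
    stageProbability-qProduct : ∀ {n} r (S : Subset n) →
      stageProbability (λ i → q⁺ ^ᵣ (r + fromℕ i - 1#)) S
        ≈ q⁺ ^ᵣ (fromℕ (n C 2) + fromℕ n * r) * (w ^ ∣ ∁ S ∣ * qProduct u r (∁ S))
    stageProbability-qProduct {n} r S = begin
      stageProbability (λ i → q⁺ ^ᵣ (r + fromℕ i - 1#)) S
        ≈⟨ product-cong trial ⟩
      product (λ i → a i * (b i * d i))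
        ≈⟨ product-distrib-* a (λ i → b i * d i) ⟩
      product a * product (λ i → b i * d i)
        ≈⟨ R.*-congˡ (product-distrib-* b d) ⟩
      product a * (product b * qProduct u r (∁ S))
        ≈⟨ R.*-cong (product-^ᵣ-progression q⁺ n r) (R.*-congʳ (product-if w (∁ S))) ⟩
      q⁺ ^ᵣ (fromℕ (n C 2) + fromℕ n * r) * (w ^ ∣ ∁ S ∣ * qProduct u r (∁ S)) ∎
      where
      t a b d : Fin n → Carrier
      t i = r + fromℕ (toℕ i)
      a i = q⁺ ^ᵣ t i
      b i = if lookup (∁ S) i then w else 1#
      d i = if lookup (∁ S) i then [ t i ]⟨ u ⟩ else 1#

      prob : Fin n → Carrier
      prob i = q⁺ ^ᵣ (r + fromℕ (suc (toℕ i)) - 1#)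

      -- The trial numbered m+1 is the element m of `Fin n`, so r + (m+1) - 1 becomes r + m.
      prob≈a : ∀ i → prob i ≈ a i
      prob≈a i = ^ᵣ-congʳ q⁺ (R.trans
        (R.+-congʳ (R.trans (R.+-congˡ (R.+-comm 1# _)) (R.sym (R.+-assoc r _ 1#))))
        (x+y-y≈x _ 1#))

      factor : ∀ i s → (if s then prob i else 1# - prob i)
                 ≈ a i * ((if not s then w else 1#) * (if not s then [ t i ]⟨ u ⟩ else 1#))
      factor i true  = R.trans (prob≈a i)
        (R.sym (R.trans (R.*-congˡ (R.*-identityʳ 1#)) (R.*-identityʳ _)))
      factor i false = R.trans (R.+-congˡ (R.-‿cong (prob≈a i))) (1-qᵗ (t i))

      -- `factor` treats the outcome as a free Boolean; `lookup-map` identifies its negation with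
      -- membership in `∁ S`.
      trial : ∀ i → (if lookup S i then prob i else 1# - prob i) ≈ a i * (b i * d i)
      trial i = R.trans (factor i (lookup S i)) (R.reflexive (≡.cong
        (λ s → a i * ((if s then w else 1#) * (if s then [ t i ]⟨ u ⟩ else 1#)))
        (≡.sym (lookup-map i not S))))

    -- After reindexing by the failure set `M`, its size is fixed at `n ∸ s`, so the power of `w` is
    -- constant and leaves the sum.
    stageSum-qProductSum : ∀ r {n s} → s ℕ.≤ n →
      stageSum (λ i → q⁺ ^ᵣ (r + fromℕ i - 1#)) n s
        ≈ q⁺ ^ᵣ (fromℕ (n C 2) + fromℕ n * r) * (w ^ (n ∸ s) * qProductSum u r n (n ∸ s))
    stageSum-qProductSum r {n} {s} s≤n = begin
      stageSum (λ i → q⁺ ^ᵣ (r + fromℕ i - 1#)) n s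
        ≈⟨ sumList-cong (stageProbability-qProduct r) (subsetsOfSize n s) ⟩
      sumList (map (λ S → K * (w ^ ∣ ∁ S ∣ * qProduct u r (∁ S))) (subsetsOfSize n s))
        ≈⟨ sumList-subsetsOfSize-∁ s≤n (λ M → K * (w ^ ∣ M ∣ * qProduct u r M)) ⟩
      sumList (map (λ M → K * (w ^ ∣ M ∣ * qProduct u r M)) (subsetsOfSize n (n ∸ s)))
        ≈⟨ sumList-filter-cong (λ M → ∣ M ∣ ≟ n ∸ s)
             (λ ∣M∣≡m → R.*-congˡ (R.*-congʳ (^-congʳ w ∣M∣≡m))) (subsets n) ⟩
      sumList (map (λ M → K * (w ^ (n ∸ s) * qProduct u r M)) (subsetsOfSize n (n ∸ s)))
        ≈⟨ *-distribˡ-sumList K _ (subsetsOfSize n (n ∸ s)) ⟨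
      K * sumList (map (λ M → w ^ (n ∸ s) * qProduct u r M) (subsetsOfSize n (n ∸ s)))
        ≈⟨ R.*-congˡ (*-distribˡ-sumList (w ^ (n ∸ s)) (qProduct u r) (subsetsOfSize n (n ∸ s))) ⟨
      K * (w ^ (n ∸ s) * qProductSum u r n (n ∸ s)) ∎
      where K = q⁺ ^ᵣ (fromℕ (n C 2) + fromℕ n * r)

    -- Assembling the stages.

    module _ {k} (n : ℕ) (r : Vector Carrier k) (x : Vector ℕ k) (Σx≤n : sumℕ x ℕ.≤ n) where

      private
        F : ℕ
        F = sumℕ (failures n x)

        Q : Carrier
        Q = product (λ i → qProductSum u (r i) (trials n x i) (failures n x i))

      ℙ≈signlessStirling :
        ℙ {k} {n} (λ j i → q⁺ ^ᵣ (r j + fromℕ i - 1#)) (λ ω → all? (λ j → X j ω ≟ x j))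
          ≈ q⁺ ^ᵣ (fromℕ (sumℕ (λ j → trials n x j C 2)) + sum (λ j → fromℕ (trials n x j) * r j))
            * (1# - q) ^ F * signlessStirling u n x r
      ℙ≈signlessStirling = begin
        ℙ {k} {n} (λ j i → q⁺ ^ᵣ (r j + fromℕ i - 1#)) (λ ω → all? (λ j → X j ω ≟ x j))
          ≈⟨ ℙ-product k n _ x ⟩
        product (λ j → stageSum (λ i → q⁺ ^ᵣ (r j + fromℕ i - 1#)) (trials n x j) (x j))
          ≈⟨ product-cong stage ⟩
        product (λ j → q⁺ ^ᵣ e j * (w ^ failures n x j * s j))
          ≈⟨ product-distrib-* (λ j → q⁺ ^ᵣ e j) (λ j → w ^ failures n x j * s j) ⟩
        product (λ j → q⁺ ^ᵣ e j) * product (λ j → w ^ failures n x j * s j)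
          ≈⟨ R.*-congˡ (product-distrib-* (λ j → w ^ failures n x j) s) ⟩
        product (λ j → q⁺ ^ᵣ e j) * (product (λ j → w ^ failures n x j) * Q)
          ≈⟨ R.*-cong (R.trans (product-^ᵣ q⁺ e) (^ᵣ-congʳ q⁺ (sum-fromℕ-+ (λ j → trials n x j C 2) _)))
               (R.*-congʳ (R.trans (product-^ w (failures n x)) (^-distrib-* (1# - q) q⁻¹ F))) ⟩
        q⁺ ^ᵣ E * ((1# - q) ^ F * q⁻¹ ^ F * Q)
          -- The power of `q⁻¹` coming from `w` joins `Q`, where it is exactly the prefactor of the
          -- signless numbers.
          ≈⟨ solve 4 (λ a b c d → (a ⊕ ((b ⊕ c) ⊕ d)) ⊜ ((a ⊕ b) ⊕ (c ⊕ d))) R.refl _ _ _ _ ⟩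
        q⁺ ^ᵣ E * (1# - q) ^ F * (q⁻¹ ^ F * Q)
          ≈⟨ R.*-congˡ (signlessStirling-product u n x r Σx≤n) ⟨
        q⁺ ^ᵣ E * (1# - q) ^ F * signlessStirling u n x r ∎
        where
        e s : Fin k → Carrier
        e j = fromℕ (trials n x j C 2) + fromℕ (trials n x j) * r j
        s j = qProductSum u (r j) (trials n x j) (failures n x j)

        E : Carrier
        E = fromℕ (sumℕ (λ j → trials n x j C 2)) + sum (λ j → fromℕ (trials n x j) * r j)

        stage : ∀ j → stageSum (λ i → q⁺ ^ᵣ (r j + fromℕ i - 1#)) (trials n x j) (x j)
                        ≈ q⁺ ^ᵣ e j * (w ^ failures n x j * s j)
        stage j = R.trans (stageSum-qProductSum (r j) (x≤trials n x Σx≤n j)) (R.reflexive (≡.cong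
          (λ m → q⁺ ^ᵣ e j * (w ^ m * qProductSum u (r j) (trials n x j) m))
          (≡.sym (failures≡trials∸x n x j))))

      -- Both kinds are multiples of `Q`, with prefactors `q⁻¹ ^ F` and `(- 1#) ^ F`.
      signlessStirling≈signedStirling :
        signlessStirling u n x r ≈ (- 1#) ^ F * q⁺ ^ᵣ (- fromℕ F) * signedStirling u n x r
      signlessStirling≈signedStirling = begin
        signlessStirling u n x r
          ≈⟨ signlessStirling-product u n x r Σx≤n ⟩
        q⁻¹ ^ F * Q
          ≈⟨ R.*-congʳ (q⁻¹^n F) ⟩
        g * Q
          -- The sign is inserted twice: one copy stays in front, the other turns `Q` into the
          -- signed number.
          ≈⟨ R.trans (R.sym (R.*-identityˡ _)) (R.*-congʳ (R.sym ([-1]^n*[-1]^n≈1 F))) ⟩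
        σ * σ * (g * Q)
          ≈⟨ solve 3 (λ a b c → ((a ⊕ a) ⊕ (b ⊕ c)) ⊜ ((a ⊕ b) ⊕ (a ⊕ c))) R.refl σ g Q ⟩
        σ * g * (σ * Q)
          ≈⟨ R.*-congˡ (signedStirling-product u n x r) ⟨
        σ * g * signedStirling u n x r ∎
        where
        σ = (- 1#) ^ F
        g = q⁺ ^ᵣ (- fromℕ F)

theorem9 :
  ∀ {c ℓ₁ ℓ₂ : Level} (ℝ : RealNumbers c ℓ₁ ℓ₂) →
  let open RealNumbers ℝ
      open RealTheory ℝ in
  ∀ (q : Carrier) (0<q : 0# < q) (q<1 : q < 1#) →
  ∀ (k n : ℕ) → 1 ℕ.≤ k → 1 ℕ.≤ n →
  ∀ (r : Vector Carrier k) → (∀ j → 0# ≤ r j) →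
  let q⁺ : ℝ⁺
      q⁺ = q , 0<q
      q⁻¹ : Base
      q⁻¹ = reciprocalBase q 0<q q<1
      p : Vector (ℕ → Carrier) k
      p = λ j i → q⁺ ^ᵣ (r j + fromℕ i - 1#) in
  ∀ (x : Vector ℕ k) → sumℕ x ℕ.≤ n →
  (ℙ {k} {n} p (λ ω → all? (λ j → X j ω ≟ x j))
    ≈ q⁺ ^ᵣ (fromℕ (sumℕ (λ j → trials n x j C 2)) + sum (λ j → fromℕ (trials n x j) * r j))
      * (1# - q) ^ sumℕ (failures n x)
      * signlessStirling q⁻¹ n x r)
  × (signlessStirling q⁻¹ n x r
    ≈ (- 1#) ^ sumℕ (failures n x)
      * q⁺ ^ᵣ (- fromℕ (sumℕ (failures n x)))
      * signedStirling q⁻¹ n x r)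
theorem9 ℝ q 0<q q<1 k n _ _ r _ x Σx≤n =
  ℙ≈signlessStirling ℝ q 0<q q<1 n r x Σx≤n ,
  signlessStirling≈signedStirling ℝ q 0<q q<1 n r x Σx≤n
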